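{- For any terms $\mathbf t,\mathbf t'$, any context $\Gamma$ and any type $T$ of the system Additive, if $\mathbf t\to^*\mathbf t'$ and $\Gamma\vdash\mathbf t:T$ is derivable, then $\Gamma\vdash\mathbf t':T$ is derivable.
   Context: Language. Terms and values are defined by mutual induction: terms $\mathbf t,\mathbf u,\mathbf s ::= \mathbf v \mid \mathbf t\,\mathbf u \mid \mathbf t+\mathbf u \mid \mathbf 0$; values $\mathbf v ::= x \mid \lambda x.\mathbf t$. Terms are considered up to $\alpha$-conversion and modulo associativity and commutativity of $+$ (AC-rewriting). The one-step reduction $\to$ is generated (on any subterm) by the six rules: $(\mathbf t+\mathbf u)\mathbf s\to\mathbf t\mathbf s+\mathbf u\mathbf s$; $\mathbf t(\mathbf u+\mathbf s)\to\mathbf t\mathbf u+\mathbf t\mathbf s$; $\mathbf 0\mathbf t\to\mathbf 0$; $\mathbf t\mathbf 0\to\mathbf 0$; $\mathbf t+\mathbf 0\to\mathbf t$; and $(\lambda x.\mathbf t)\mathbf v\to\mathbf t\{\mathbf v/x\}$ where $\mathbf v$ is a value. $\to^*$ is the reflexive transitive closure of $\to$. Types of the system Additive. Types $T,R,S ::= U \mid T+R \mid \overline 0$; unit types $U,V,W ::= X \mid U\to T \mid \forall X.U$ (with $X$ a type variable). $T[U/X]$ is capture-avoiding substitution of a unit type for a type variable, and $T[\vec U/\vec X]$ stands for $T[U_1/X_1]\cdots[U_n/X_n]$ (where $X_i$ is not free in $U_j$ for $j<i$). $\equiv$ is the least congruence on types with $T+R\equiv R+T$, $T+(R+S)\equiv(T+R)+S$,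 $T+\overline 0\equiv T$. Notation: $\sum_{i=1}^{0}T_i=\overline 0$ and $\sum_{i=1}^{\alpha}T_i=\sum_{i=1}^{\alpha-1}T_i+T_\alpha$ for $\alpha\ge 1$. A context $\Gamma$ is a set of pairs $x:U$ ($U$ a unit type) with each term variable appearing at most once; $FV(\Gamma)$ is its set of free type variables. Typing rules of Additive: (ax) $\Gamma,x:U\vdash x:U$. (ax$_{\overline 0}$) $\Gamma\vdash\mathbf 0:\overline 0$. ($\equiv$) from $\Gamma\vdash\mathbf t:T$ and $T\equiv R$ infer $\Gamma\vdash\mathbf t:R$. ($\to_I$) from $\Gamma,x:U\vdash\mathbf t:T$ infer $\Gamma\vdash\lambda x.\mathbf t:U\to T$. ($\to_E$) from $\Gamma\vdash\mathbf t:\sum_{i=1}^{\alpha}\forall\vec X.(U\to T_i)$ and $\Gamma\vdash\mathbf u:\sum_{j=1}^{\beta}U[\vec V_j/\vec X]$ infer $\Gamma\vdash\mathbf t\mathbf u:\sum_{i=1}^{\alpha}\sum_{j=1}^{\beta}T_i[\vec V_j/\vec X]$. ($+_I$) from $\Gamma\vdash\mathbf t:T$ and $\Gamma\vdash\mathbf u:R$ infer $\Gamma\vdash\mathbf t+\mathbf u:T+R$. ($\forall_E$) from $\Gamma\vdash\mathbf t:\forall X.U$ infer $\Gamma\vdash\mathbf t:U[V/X]$ ($V$ a unit type). ($\forall_I$) from $\Gamma\vdash\mathbf t:U$ and $X\notin FV(\Gamma)$ infer $\Gamma\vdash\mathbf t:\forall X.U$. -}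

module Defs where

open import Data.Fin using (Fin; zero; suc; lift)
open import Data.Nat as ℕ using (ℕ; zero; suc)
open import Data.Product using (∃₂; _×_)
open import Data.Vec as Vec using (Vec; lookup)
open import Data.Vec.Functional using (Vector; init; last; _∷_; _++_)
open import Function using (_∘_)
open import Relation.Binary using (Rel)
open import Relation.Binary.Construct.Closure.ReflexiveTransitive using (Star)
open import Relation.Binary.Construct.Union using (_∪_)
open import Level using (0ℓ)

private
  variable
    k l m n α β : ℕ

infixl 25 _·_
infixl 20 _+_ _⊕_
infixr 22 _⇒_
infix  10 _≈_ _≋_ _↦_ _⟶_ _⟶*_ _⊢_∶_

-- Both terms and types are well-scoped de Bruijn syntax, so syntactic
-- equality is α-equality: `Term n` has its free variables among n term
-- variables, and `Type k` among k type variables.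

mutual
  data Term (n : ℕ) : Set where
    val : Value n → Term n
    _·_ : Term n → Term n → Term n
    _+_ : Term n → Term n → Term n
    𝟎   : Term n

  data Value (n : ℕ) : Set where
    var : Fin n → Value n
    ƛ_  : Term (suc n) → Value n

mutual
  renᵗ : (Fin m → Fin n) → Term m → Term n
  renᵗ ρ (val v) = val (renᵛ ρ v)
  renᵗ ρ (t · u) = renᵗ ρ t · renᵗ ρ u
  renᵗ ρ (t + u) = renᵗ ρ t + renᵗ ρ u
  renᵗ ρ 𝟎       = 𝟎

  renᵛ : (Fin m → Fin n) → Value m → Value n
  renᵛ ρ (var x) = var (ρ x)
  renᵛ ρ (ƛ t)   = ƛ renᵗ (lift 1 ρ) t

mutual
  subᵗ : (Fin m → Value n) → Term m → Term n
  subᵗ σ (val v) = val (subᵛ σ v)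
  subᵗ σ (t · u) = subᵗ σ t · subᵗ σ u
  subᵗ σ (t + u) = subᵗ σ t + subᵗ σ u
  subᵗ σ 𝟎       = 𝟎

  subᵛ : (Fin m → Value n) → Value m → Value n
  subᵛ σ (var x) = σ x
  subᵛ σ (ƛ t)   = ƛ subᵗ (var zero ∷ (renᵛ suc ∘ σ)) t

_⟨_⟩ : Term (suc n) → Value n → Term n
t ⟨ v ⟩ = subᵗ (v ∷ var) t

data _≈_ {n : ℕ} : Rel (Term n) 0ℓ where
  +-comm  : ∀ {t u}   → t + u ≈ u + t
  +-assoc : ∀ {t u s} → (t + u) + s ≈ t + (u + s)
  ≈-refl  : ∀ {t}     → t ≈ t
  ≈-sym   : ∀ {t u}   → t ≈ u → u ≈ t
  ≈-trans : ∀ {t u s} → t ≈ u → u ≈ s → t ≈ s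
  ƛ-cong  : ∀ {t t′}  → t ≈ t′ → val (ƛ t) ≈ val (ƛ t′)
  ·-cong  : ∀ {t t′ u u′} → t ≈ t′ → u ≈ u′ → t · u ≈ t′ · u′
  +-cong  : ∀ {t t′ u u′} → t ≈ t′ → u ≈ u′ → t + u ≈ t′ + u′

data _↦_ {n : ℕ} : Rel (Term n) 0ℓ where
  distribʳ : ∀ {t u s} → (t + u) · s ↦ t · s + u · s
  distribˡ : ∀ {t u s} → t · (u + s) ↦ t · u + t · s
  zeroˡ    : ∀ {t}     → 𝟎 · t ↦ 𝟎
  zeroʳ    : ∀ {t}     → t · 𝟎 ↦ 𝟎
  +-zero   : ∀ {t}     → t + 𝟎 ↦ t
  beta     : ∀ {t v}   → val (ƛ t) · val v ↦ t ⟨ v ⟩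
  ξ-ƛ      : ∀ {t t′}   → t ↦ t′ → val (ƛ t) ↦ val (ƛ t′)
  ξ-·ˡ     : ∀ {t t′ u} → t ↦ t′ → t · u ↦ t′ · u
  ξ-·ʳ     : ∀ {t u u′} → u ↦ u′ → t · u ↦ t · u′
  ξ-+ˡ     : ∀ {t t′ u} → t ↦ t′ → t + u ↦ t′ + u
  ξ-+ʳ     : ∀ {t u u′} → u ↦ u′ → t + u ↦ t + u′

-- One-step reduction modulo AC.
_⟶_ : Rel (Term n) 0ℓ
t ⟶ t′ = ∃₂ λ s s′ → t ≈ s × s ↦ s′ × s′ ≈ t′

-- Reflexive transitive closure modulo AC: reflexivity is up to _≈_, since
-- AC-equal terms are the same term.
_⟶*_ : Rel (Term n) 0ℓ
_⟶*_ = Star (_≈_ ∪ _⟶_)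

mutual
  data Type (k : ℕ) : Set where
    unit : UnitType k → Type k
    _⊕_  : Type k → Type k → Type k
    𝟘    : Type k

  data UnitType (k : ℕ) : Set where
    var : Fin k → UnitType k
    _⇒_ : UnitType k → Type k → UnitType k
    Π_  : UnitType (suc k) → UnitType k   -- ∀X.U

mutual
  ren : (Fin k → Fin l) → Type k → Type l
  ren ρ (unit U) = unit (renᵘ ρ U)
  ren ρ (T ⊕ R)  = ren ρ T ⊕ ren ρ R
  ren ρ 𝟘        = 𝟘

  renᵘ : (Fin k → Fin l) → UnitType k → UnitType l
  renᵘ ρ (var X) = var (ρ X)
  renᵘ ρ (U ⇒ T) = renᵘ ρ U ⇒ ren ρ T
  renᵘ ρ (Π U)   = Π renᵘ (lift 1 ρ) U

mutual
  sub : (Fin k → UnitType l) → Type k → Type l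
  sub σ (unit U) = unit (subᵘ σ U)
  sub σ (T ⊕ R)  = sub σ T ⊕ sub σ R
  sub σ 𝟘        = 𝟘

  subᵘ : (Fin k → UnitType l) → UnitType k → UnitType l
  subᵘ σ (var X) = σ X
  subᵘ σ (U ⇒ T) = subᵘ σ U ⇒ sub σ T
  subᵘ σ (Π U)   = Π subᵘ (var zero ∷ (renᵘ suc ∘ σ)) U

-- T[V₁/X₁]⋯[Vₘ/Xₘ] for the m innermost type variables.  The proviso that Xᵢ
-- is not free in Vⱼ for j < i makes the iterated substitution simultaneous;
-- here it holds by scoping, as the Vⱼ live outside the m binders.
_[_] : Type (m ℕ.+ k) → Vector (UnitType k) m → Type k
T [ V ] = sub (V ++ var) T

_[_]ᵘ : UnitType (m ℕ.+ k) → Vector (UnitType k) m → UnitType k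
U [ V ]ᵘ = subᵘ (V ++ var) U

Π* : ∀ m → UnitType (m ℕ.+ k) → UnitType k
Π* zero    U = U
Π* (suc m) U = Π* m (Π U)

data _≋_ {k : ℕ} : Rel (Type k) 0ℓ where
  ⊕-comm      : ∀ {T R}   → T ⊕ R ≋ R ⊕ T
  ⊕-assoc     : ∀ {T R S} → T ⊕ (R ⊕ S) ≋ (T ⊕ R) ⊕ S
  ⊕-identityʳ : ∀ {T}     → T ⊕ 𝟘 ≋ T
  ≋-refl      : ∀ {T}     → T ≋ T
  ≋-sym       : ∀ {T R}   → T ≋ R → R ≋ T
  ≋-trans     : ∀ {T R S} → T ≋ R → R ≋ S → T ≋ S
  ⊕-cong      : ∀ {T T′ R R′} → T ≋ T′ → R ≋ R′ → T ⊕ R ≋ T′ ⊕ R′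
  ⇒-cong      : ∀ {U U′ T T′} → unit U ≋ unit U′ → T ≋ T′ →
                unit (U ⇒ T) ≋ unit (U′ ⇒ T′)
  Π-cong      : ∀ {U U′} → unit U ≋ unit U′ → unit (Π U) ≋ unit (Π U′)

∑ : Vector (Type k) α → Type k
∑ {α = zero}  T = 𝟘
∑ {α = suc α} T = ∑ (init T) ⊕ last T

Context : ℕ → ℕ → Set
Context k n = Vec (UnitType k) n

-- Typing is stated on representatives of AC-classes.  No rule closes it under
-- _≈_; its AC-invariance is part of subject reduction, as _≈_ implies _⟶*_.
data _⊢_∶_ {k n : ℕ} (Γ : Context k n) : Term n → Type k → Set where
  ax   : ∀ x → Γ ⊢ val (var x) ∶ unit (lookup Γ x)

  ax-𝟘 : Γ ⊢ 𝟎 ∶ 𝟘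

  conv : ∀ {t T R} → Γ ⊢ t ∶ T → T ≋ R → Γ ⊢ t ∶ R

  ⇒-I  : ∀ {t U T} → (U Vec.∷ Γ) ⊢ t ∶ T → Γ ⊢ val (ƛ t) ∶ unit (U ⇒ T)

  ⇒-E  : ∀ {t u} {U : UnitType (m ℕ.+ k)}
         {T : Vector (Type (m ℕ.+ k)) α}
         {V : Vector (Vector (UnitType k) m) β} →
         Γ ⊢ t ∶ ∑ (λ i → unit (Π* m (U ⇒ T i))) →
         Γ ⊢ u ∶ ∑ (λ j → unit (U [ V j ]ᵘ)) →
         Γ ⊢ t · u ∶ ∑ (λ i → ∑ (λ j → T i [ V j ]))

  +-I  : ∀ {t u T R} → Γ ⊢ t ∶ T → Γ ⊢ u ∶ R → Γ ⊢ t + u ∶ T ⊕ R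

  Π-E  : ∀ {t U} → Γ ⊢ t ∶ unit (Π U) →
         ∀ V → Γ ⊢ t ∶ unit (subᵘ (V ∷ var) U)

  -- Weakening Γ expresses X ∉ FV(Γ) for the type variable X being bound.
  Π-I  : ∀ {t U} → Vec.map (renᵘ suc) Γ ⊢ t ∶ unit U → Γ ⊢ t ∶ unit (Π U)

{-# OPTIONS --safe #-}
module Submission where

-- Each reduction rule, and each axiom of AC-equality in both directions,
-- preserves typing; these facts are closed under the term constructors, and a
-- reduction sequence chains them.  In every case the derivation is inspected
-- through a generation lemma, proved by induction on derivations.
--
-- The delicate point is that ≋ relates a type to sums of any shape, so a
-- generation lemma must survive conversion.  Inverting ≋ through normal forms is
-- avoided: a property of types is defined by recursion on the type, and is
-- shown invariant by induction on ≋.  `Zero` says that a type is an empty sum,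
-- `One P` that it is a single unit type satisfying P, and `Reads f g T R` that T
-- is a sum of unit types f a whose homomorphic image, f a being sent to g a,
-- is R.  From the last one, `split-∑` shows that if T ⊕ S ≋ ∑ᵢ f (aᵢ) then the
-- family a can be distributed between T and S; this is what the two
-- distributivity rules need, on the function and on the argument side.
--
-- The term 𝟎 has only types that are `Zero`, and a value only types that are
-- `One`, so in the zero rules one of the sums of ⇒-E is empty, and in a
-- β-redex both are singletons.  For a β-redex, `Body Γ t U` defines by recursion
-- on U what an abstraction of body t must satisfy to have type U: at an arrow
-- the body is typed under the extended context, and at a quantifier the
-- condition moves under the binder.  It is stable under type substitution, which
-- settles Π-E, and so no ordering of types by generalisation and instantiation
-- is needed.  Reading `Body` at Π* m (U ⇒ T), substituting for the m type
-- variables and then the argument for the term variable gives the typing of the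
-- contractum.
--
-- For t + u, generation yields types of t and u whose sum is the given type.
-- When Π-I or Π-E is applied to a sum of unit type, one summand carries the unit
-- type and the other is ≋ 𝟘, which is unaffected by the quantifier.

open import Defs
open import Data.Nat using (ℕ)

open import Algebra.Bundles using (CommutativeMonoid)
import Algebra.Properties.CommutativeSemigroup as CommutativeSemigroupProperties
open import Data.Empty using (⊥)
open import Data.Fin using (Fin; zero; suc; lift; splitAt)
open import Data.Nat as ℕ using (zero; suc)
open import Data.Product using (∃-syntax; _×_; _,_; proj₁; proj₂)
open import Data.Sum using (_⊎_; inj₁; inj₂)
open import Data.Unit using (⊤; tt)
open import Data.Vec as Vec using (lookup)
open import Data.Vec.Functional using (Vector; init; last; tail; []; _∷_; _++_)
open import Data.Vec.Properties using (lookup-map)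
open import Function using (_∘_; id)
open import Level using (0ℓ)
open import Relation.Binary.Construct.Closure.ReflexiveTransitive using (ε; _◅_)
open import Relation.Binary.PropositionalEquality
  using (_≡_; refl; sym; trans; cong; cong₂; subst)

private
  variable
    k l m n α β : ℕ

-- Substitution calculus of types.  Each fusion law is stated for an arbitrary
-- substitution θ pointwise equal to the composite, which makes it usable
-- without function extensionality.

-- The substitution σ carried under one type binder.
exts : (Fin k → UnitType l) → Fin (suc k) → UnitType (suc l)
exts σ = var zero ∷ (renᵘ suc ∘ σ)

private
  lift-fuse : {ρ : Fin k → Fin l} {ρ′ : Fin l → Fin m} {θ : Fin k → Fin m} →
              (∀ i → ρ′ (ρ i) ≡ θ i) → ∀ i → lift 1 ρ′ (lift 1 ρ i) ≡ lift 1 θ i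
  lift-fuse h zero    = refl
  lift-fuse h (suc i) = cong suc (h i)

  exts-lift : {ρ : Fin k → Fin l} {σ : Fin l → UnitType m} {θ : Fin k → UnitType m} →
              (∀ i → σ (ρ i) ≡ θ i) → ∀ i → exts σ (lift 1 ρ i) ≡ exts θ i
  exts-lift h zero    = refl
  exts-lift h (suc i) = cong (renᵘ suc) (h i)

  exts-var : {σ : Fin k → UnitType k} → (∀ i → σ i ≡ var i) → ∀ i → exts σ i ≡ var i
  exts-var h zero    = refl
  exts-var h (suc i) = cong (renᵘ suc) (h i)

mutual
  ren-ren : {ρ : Fin k → Fin l} {ρ′ : Fin l → Fin m} {θ : Fin k → Fin m} →
            (∀ i → ρ′ (ρ i) ≡ θ i) → ∀ T → ren ρ′ (ren ρ T) ≡ ren θ T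
  ren-ren h (unit U) = cong unit (ren-renᵘ h U)
  ren-ren h (T ⊕ R)  = cong₂ _⊕_ (ren-ren h T) (ren-ren h R)
  ren-ren h 𝟘        = refl

  ren-renᵘ : {ρ : Fin k → Fin l} {ρ′ : Fin l → Fin m} {θ : Fin k → Fin m} →
             (∀ i → ρ′ (ρ i) ≡ θ i) → ∀ U → renᵘ ρ′ (renᵘ ρ U) ≡ renᵘ θ U
  ren-renᵘ h (var X) = cong var (h X)
  ren-renᵘ h (U ⇒ T) = cong₂ _⇒_ (ren-renᵘ h U) (ren-ren h T)
  ren-renᵘ h (Π U)   = cong Π_ (ren-renᵘ (lift-fuse h) U)

mutual
  sub-ren : {ρ : Fin k → Fin l} {σ : Fin l → UnitType m} {θ : Fin k → UnitType m} →
            (∀ i → σ (ρ i) ≡ θ i) → ∀ T → sub σ (ren ρ T) ≡ sub θ T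
  sub-ren h (unit U) = cong unit (sub-renᵘ h U)
  sub-ren h (T ⊕ R)  = cong₂ _⊕_ (sub-ren h T) (sub-ren h R)
  sub-ren h 𝟘        = refl

  sub-renᵘ : {ρ : Fin k → Fin l} {σ : Fin l → UnitType m} {θ : Fin k → UnitType m} →
             (∀ i → σ (ρ i) ≡ θ i) → ∀ U → subᵘ σ (renᵘ ρ U) ≡ subᵘ θ U
  sub-renᵘ h (var X) = h X
  sub-renᵘ h (U ⇒ T) = cong₂ _⇒_ (sub-renᵘ h U) (sub-ren h T)
  sub-renᵘ h (Π U)   = cong Π_ (sub-renᵘ (exts-lift h) U)

private
  ren-exts : {σ : Fin k → UnitType l} {ρ : Fin l → Fin m} {θ : Fin k → UnitType m} →
             (∀ i → renᵘ ρ (σ i) ≡ θ i) → ∀ i → renᵘ (lift 1 ρ) (exts σ i) ≡ exts θ i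
  ren-exts h zero            = refl
  ren-exts {σ = σ} h (suc i) =
    trans (ren-renᵘ (λ _ → refl) (σ i))
          (trans (sym (ren-renᵘ (λ _ → refl) (σ i))) (cong (renᵘ suc) (h i)))

mutual
  ren-sub : {σ : Fin k → UnitType l} {ρ : Fin l → Fin m} {θ : Fin k → UnitType m} →
            (∀ i → renᵘ ρ (σ i) ≡ θ i) → ∀ T → ren ρ (sub σ T) ≡ sub θ T
  ren-sub h (unit U) = cong unit (ren-subᵘ h U)
  ren-sub h (T ⊕ R)  = cong₂ _⊕_ (ren-sub h T) (ren-sub h R)
  ren-sub h 𝟘        = refl

  ren-subᵘ : {σ : Fin k → UnitType l} {ρ : Fin l → Fin m} {θ : Fin k → UnitType m} →
             (∀ i → renᵘ ρ (σ i) ≡ θ i) → ∀ U → renᵘ ρ (subᵘ σ U) ≡ subᵘ θ U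
  ren-subᵘ h (var X) = h X
  ren-subᵘ h (U ⇒ T) = cong₂ _⇒_ (ren-subᵘ h U) (ren-sub h T)
  ren-subᵘ h (Π U)   = cong Π_ (ren-subᵘ (ren-exts h) U)

exts-renᵘ : (σ : Fin k → UnitType l) → ∀ U →
            subᵘ (exts σ) (renᵘ suc U) ≡ renᵘ suc (subᵘ σ U)
exts-renᵘ σ U = trans (sub-renᵘ (λ _ → refl) U) (sym (ren-subᵘ (λ _ → refl) U))

private
  exts-fuse : {σ : Fin k → UnitType l} {τ : Fin l → UnitType m} {θ : Fin k → UnitType m} →
              (∀ i → subᵘ τ (σ i) ≡ θ i) → ∀ i → subᵘ (exts τ) (exts σ i) ≡ exts θ i
  exts-fuse h zero                    = refl
  exts-fuse {σ = σ} {τ = τ} h (suc i) =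
    trans (exts-renᵘ τ (σ i)) (cong (renᵘ suc) (h i))

mutual
  sub-sub : {σ : Fin k → UnitType l} {τ : Fin l → UnitType m} {θ : Fin k → UnitType m} →
            (∀ i → subᵘ τ (σ i) ≡ θ i) → ∀ T → sub τ (sub σ T) ≡ sub θ T
  sub-sub h (unit U) = cong unit (sub-subᵘ h U)
  sub-sub h (T ⊕ R)  = cong₂ _⊕_ (sub-sub h T) (sub-sub h R)
  sub-sub h 𝟘        = refl

  sub-subᵘ : {σ : Fin k → UnitType l} {τ : Fin l → UnitType m} {θ : Fin k → UnitType m} →
             (∀ i → subᵘ τ (σ i) ≡ θ i) → ∀ U → subᵘ τ (subᵘ σ U) ≡ subᵘ θ U
  sub-subᵘ h (var X) = h X
  sub-subᵘ h (U ⇒ T) = cong₂ _⇒_ (sub-subᵘ h U) (sub-sub h T)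
  sub-subᵘ h (Π U)   = cong Π_ (sub-subᵘ (exts-fuse h) U)

mutual
  sub-id : {σ : Fin k → UnitType k} → (∀ i → σ i ≡ var i) → ∀ T → sub σ T ≡ T
  sub-id h (unit U) = cong unit (sub-idᵘ h U)
  sub-id h (T ⊕ R)  = cong₂ _⊕_ (sub-id h T) (sub-id h R)
  sub-id h 𝟘        = refl

  sub-idᵘ : {σ : Fin k → UnitType k} → (∀ i → σ i ≡ var i) → ∀ U → subᵘ σ U ≡ U
  sub-idᵘ h (var X) = h X
  sub-idᵘ h (U ⇒ T) = cong₂ _⇒_ (sub-idᵘ h U) (sub-id h T)
  sub-idᵘ h (Π U)   = cong Π_ (sub-idᵘ (exts-var h) U)

ren≡sub : (ρ : Fin k → Fin l) → ∀ T → ren ρ T ≡ sub (var ∘ ρ) T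
ren≡sub ρ T = trans (cong (ren ρ) (sym (sub-id (λ _ → refl) T))) (ren-sub (λ _ → refl) T)

-- Instantiation of several innermost type variables.

-- The substitution σ carried under m type binders.
exts* : ∀ m → (Fin k → UnitType l) → Fin (m ℕ.+ k) → UnitType (m ℕ.+ l)
exts* zero    σ = σ
exts* (suc m) σ = exts (exts* m σ)

sub-Π* : ∀ m (σ : Fin k → UnitType l) U → subᵘ σ (Π* m U) ≡ Π* m (subᵘ (exts* m σ) U)
sub-Π* zero    σ U = refl
sub-Π* (suc m) σ U = sub-Π* m σ (Π U)

-- Not definitional, as _++_ branches on splitAt.
++-suc : ∀ {A : Set} m (V : Vector A (suc m)) (W : Vector A k) i →
         (V ++ W) (suc i) ≡ (tail V ++ W) i
++-suc m V W i with splitAt m i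
... | inj₁ _ = refl
... | inj₂ _ = refl

private
  inst-var : ∀ m (σ : Fin k → UnitType l) (V : Vector (UnitType k) m) i →
             subᵘ ((subᵘ σ ∘ V) ++ var) (exts* m σ i) ≡ subᵘ σ ((V ++ var) i)
  inst-var zero    σ V i       = sub-idᵘ (λ _ → refl) (σ i)
  inst-var (suc m) σ V zero    = refl
  inst-var (suc m) σ V (suc i) =
    trans (sub-renᵘ (++-suc m (subᵘ σ ∘ V) var) (exts* m σ i))
          (trans (inst-var m σ (tail V) i) (cong (subᵘ σ) (sym (++-suc m V var i))))

-- Substitution commutes with instantiation, as needed for the rule ⇒-E.
sub-inst : ∀ m (σ : Fin k → UnitType l) (V : Vector (UnitType k) m) T →
           sub (exts* m σ) T [ subᵘ σ ∘ V ] ≡ sub σ (T [ V ])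
sub-inst m σ V T = trans (sub-sub (inst-var m σ V) T) (sym (sub-sub (λ _ → refl) T))

sub-instᵘ : ∀ m (σ : Fin k → UnitType l) (V : Vector (UnitType k) m) U →
            subᵘ (exts* m σ) U [ subᵘ σ ∘ V ]ᵘ ≡ subᵘ σ (U [ V ]ᵘ)
sub-instᵘ m σ V U = trans (sub-subᵘ (inst-var m σ V) U) (sym (sub-subᵘ (λ _ → refl) U))

sub-inst₁ : (σ : Fin k → UnitType l) (V : UnitType k) → ∀ U →
            subᵘ (subᵘ σ V ∷ var) (subᵘ (exts σ) U) ≡ subᵘ σ (subᵘ (V ∷ var) U)
sub-inst₁ σ V U =
  trans (sub-subᵘ {θ = subᵘ σ ∘ (V ∷ var)} pointwise U) (sym (sub-subᵘ (λ _ → refl) U))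
  where
  pointwise : ∀ i → subᵘ (subᵘ σ V ∷ var) (exts σ i) ≡ subᵘ σ ((V ∷ var) i)
  pointwise zero    = refl
  pointwise (suc i) = trans (sub-renᵘ (λ _ → refl) (σ i)) (sub-idᵘ (λ _ → refl) (σ i))

-- Types modulo ≋ as a commutative monoid.

⊕-monoid : ℕ → CommutativeMonoid 0ℓ 0ℓ
⊕-monoid k = record
  { Carrier = Type k
  ; _≈_     = _≋_
  ; _∙_     = _⊕_
  ; ε       = 𝟘
  ; isCommutativeMonoid = record
    { isMonoid = record
      { isSemigroup = record
        { isMagma = record
          { isEquivalence = record { refl = ≋-refl ; sym = ≋-sym ; trans = ≋-trans }
          ; ∙-cong        = ⊕-cong
          }
        ; assoc = λ _ _ _ → ≋-sym ⊕-assoc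
        }
      ; identity = (λ _ → ≋-trans ⊕-comm ⊕-identityʳ) , (λ _ → ⊕-identityʳ)
      }
    ; comm = λ _ _ → ⊕-comm
    }
  }

private
  module ⊕ {k : ℕ} where
    open CommutativeMonoid (⊕-monoid k) public using (commutativeSemigroup; reflexive)
    open CommutativeSemigroupProperties commutativeSemigroup public using (interchange)

  open ⊕ using (interchange) renaming (reflexive to ≡⇒≋)

⊕-identityˡ : {T : Type k} → 𝟘 ⊕ T ≋ T
⊕-identityˡ = ≋-trans ⊕-comm ⊕-identityʳ

sub-≋ : (σ : Fin k → UnitType l) {T R : Type k} → T ≋ R → sub σ T ≋ sub σ R
sub-≋ σ ⊕-comm        = ⊕-comm
sub-≋ σ ⊕-assoc       = ⊕-assoc
sub-≋ σ ⊕-identityʳ   = ⊕-identityʳ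
sub-≋ σ ≋-refl        = ≋-refl
sub-≋ σ (≋-sym p)     = ≋-sym (sub-≋ σ p)
sub-≋ σ (≋-trans p q) = ≋-trans (sub-≋ σ p) (sub-≋ σ q)
sub-≋ σ (⊕-cong p q)  = ⊕-cong (sub-≋ σ p) (sub-≋ σ q)
sub-≋ σ (⇒-cong p q)  = ⇒-cong (sub-≋ σ p) (sub-≋ σ q)
sub-≋ σ (Π-cong p)    = Π-cong (sub-≋ (exts σ) p)

ren-≋ : (ρ : Fin k → Fin l) {T R : Type k} → T ≋ R → ren ρ T ≋ ren ρ R
ren-≋ ρ {T} {R} p =
  ≋-trans (≡⇒≋ (ren≡sub ρ T)) (≋-trans (sub-≋ (var ∘ ρ) p) (≡⇒≋ (sym (ren≡sub ρ R))))

∑-cong : {F G : Vector (Type k) α} → (∀ i → F i ≋ G i) → ∑ F ≋ ∑ G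
∑-cong {α = zero}  h = ≋-refl
∑-cong {α = suc α} h = ⊕-cong (∑-cong (λ i → h _)) (h _)

∑-𝟘 : ∀ α → ∑ {k = k} {α = α} (λ _ → 𝟘) ≋ 𝟘
∑-𝟘 zero    = ≋-refl
∑-𝟘 (suc α) = ≋-trans ⊕-identityʳ (∑-𝟘 α)

∑-⊕ : (F G : Vector (Type k) α) → ∑ (λ i → F i ⊕ G i) ≋ ∑ F ⊕ ∑ G
∑-⊕ {α = zero}  F G = ≋-sym ⊕-identityʳ
∑-⊕ {α = suc α} F G =
  ≋-trans (⊕-cong (∑-⊕ (init F) (init G)) ≋-refl) (interchange _ _ _ _)

∑-swap : (F : Fin α → Fin β → Type k) → ∑ (λ i → ∑ (λ j → F i j)) ≋ ∑ (λ j → ∑ (λ i → F i j))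
∑-swap {α = zero}  {β = β} F = ≋-sym (∑-𝟘 β)
∑-swap {α = suc α} {β = β} F =
  ≋-trans (⊕-cong (∑-swap (init F)) ≋-refl) (≋-sym (∑-⊕ {α = β} _ _))

∑-∷ : (F : Vector (Type k) (suc α)) → ∑ F ≋ F zero ⊕ ∑ (tail F)
∑-∷ {α = zero}  F = ⊕-comm
∑-∷ {α = suc α} F = ≋-trans (⊕-cong (∑-∷ (init F)) ≋-refl) (≋-sym ⊕-assoc)

∑-++ : ∀ {A : Set} (g : A → Type k) (a : Vector A α) (b : Vector A β) →
       ∑ (g ∘ (a ++ b)) ≋ ∑ (g ∘ a) ⊕ ∑ (g ∘ b)
∑-++ {α = zero}          g a b = ≋-sym ⊕-identityˡ
∑-++ {α = suc α} {β = β} g a b =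
  ≋-trans (∑-∷ (g ∘ (a ++ b)))
  (≋-trans (⊕-cong ≋-refl (≋-trans (∑-cong (λ i → ≡⇒≋ (cong g (++-suc α a b i))))
                                   (∑-++ g (tail a) b)))
  (≋-trans ⊕-assoc (⊕-cong (≋-sym (∑-∷ (g ∘ a))) ≋-refl)))

sub-∑ : (σ : Fin k → UnitType l) (F : Vector (Type k) α) → sub σ (∑ F) ≡ ∑ (sub σ ∘ F)
sub-∑ {α = zero}  σ F = refl
sub-∑ {α = suc α} σ F = cong₂ _⊕_ (sub-∑ σ (init F)) refl

-- Inversion of ≋.

-- The type is a sum without unit summands.
Zero : Type k → Set
Zero (unit U) = ⊥
Zero (T ⊕ R)  = Zero T × Zero R
Zero 𝟘        = ⊤

Zero⇒≋𝟘 : (T : Type k) → Zero T → T ≋ 𝟘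
Zero⇒≋𝟘 (T ⊕ R) (p , q) = ≋-trans (⊕-cong (Zero⇒≋𝟘 T p) (Zero⇒≋𝟘 R q)) ⊕-identityʳ
Zero⇒≋𝟘 𝟘       tt      = ≋-refl

Zero-≋ : {T R : Type k} → T ≋ R → (Zero T → Zero R) × (Zero R → Zero T)
Zero-≋ ⊕-comm        = (λ (p , q) → q , p) , (λ (p , q) → q , p)
Zero-≋ ⊕-assoc       = (λ (p , q , r) → (p , q) , r) , (λ ((p , q) , r) → p , q , r)
Zero-≋ ⊕-identityʳ   = proj₁ , (_, tt)
Zero-≋ ≋-refl        = id , id
Zero-≋ (≋-sym p)     = let f , g = Zero-≋ p in g , f
Zero-≋ (≋-trans p q) =
  let f , g = Zero-≋ p; f′ , g′ = Zero-≋ q in f′ ∘ f , g ∘ g′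
Zero-≋ (⊕-cong p q)  =
  let f , g = Zero-≋ p; f′ , g′ = Zero-≋ q
  in (λ (x , y) → f x , f′ y) , (λ (x , y) → g x , g′ y)
Zero-≋ (⇒-cong p q)  = id , id
Zero-≋ (Π-cong p)    = id , id

-- The type is a sum with exactly one unit summand, which satisfies P.
One : (UnitType k → Set) → Type k → Set
One P (unit U) = P U
One P (T ⊕ R)  = (One P T × Zero R) ⊎ (Zero T × One P R)
One P 𝟘        = ⊥

-- The structural presentation of ≋ between unit types: equal head constructors
-- and equivalent components.
data _≋ᵘ_ {k : ℕ} : UnitType k → UnitType k → Set where
  var : ∀ X → var X ≋ᵘ var X
  _⇒_ : ∀ {U U′ T T′} → U ≋ᵘ U′ → T ≋ T′ → (U ⇒ T) ≋ᵘ (U′ ⇒ T′)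
  Π_  : ∀ {U U′} → U ≋ᵘ U′ → (Π U) ≋ᵘ (Π U′)

≋ᵘ-refl : (U : UnitType k) → U ≋ᵘ U
≋ᵘ-refl (var X) = var X
≋ᵘ-refl (U ⇒ T) = ≋ᵘ-refl U ⇒ ≋-refl
≋ᵘ-refl (Π U)   = Π ≋ᵘ-refl U

≋ᵘ-sym : {U V : UnitType k} → U ≋ᵘ V → V ≋ᵘ U
≋ᵘ-sym (var X) = var X
≋ᵘ-sym (p ⇒ q) = ≋ᵘ-sym p ⇒ ≋-sym q
≋ᵘ-sym (Π p)   = Π ≋ᵘ-sym p

≋ᵘ-trans : {U V W : UnitType k} → U ≋ᵘ V → V ≋ᵘ W → U ≋ᵘ W
≋ᵘ-trans (var X) (var X) = var X
≋ᵘ-trans (p ⇒ q) (r ⇒ s) = ≋ᵘ-trans p r ⇒ ≋-trans q s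
≋ᵘ-trans (Π p)   (Π q)   = Π ≋ᵘ-trans p q

≋ᵘ⇒≋ : {U V : UnitType k} → U ≋ᵘ V → unit U ≋ unit V
≋ᵘ⇒≋ (var X) = ≋-refl
≋ᵘ⇒≋ (p ⇒ q) = ⇒-cong (≋ᵘ⇒≋ p) q
≋ᵘ⇒≋ (Π p)   = Π-cong (≋ᵘ⇒≋ p)

-- P is invariant under equivalence of unit types.
Respects : (UnitType k → Set) → Set
Respects P = ∀ {U V} → U ≋ᵘ V → P U → P V

-- Both directions at once because of ≋-sym.  The cases of the congruences need
-- the inversion of unit U ≋ unit V, which is the instance P = (U ≋ᵘ_) at a
-- smaller derivation; hence the mutual recursion.
mutual
  One-≋′ : {P : UnitType k → Set} → Respects P → {T R : Type k} → T ≋ R →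
           (One P T → One P R) × (One P R → One P T)
  One-≋′ r ⊕-comm =
    (λ { (inj₁ (p , q)) → inj₂ (q , p) ; (inj₂ (p , q)) → inj₁ (q , p) }) ,
    (λ { (inj₁ (p , q)) → inj₂ (q , p) ; (inj₂ (p , q)) → inj₁ (q , p) })
  One-≋′ r ⊕-assoc =
    (λ { (inj₁ (p , q , s))        → inj₁ (inj₁ (p , q) , s)
       ; (inj₂ (p , inj₁ (q , s))) → inj₁ (inj₂ (p , q) , s)
       ; (inj₂ (p , inj₂ (q , s))) → inj₂ ((p , q) , s) }) ,
    (λ { (inj₁ (inj₁ (p , q) , s)) → inj₁ (p , q , s)
       ; (inj₁ (inj₂ (p , q) , s)) → inj₂ (p , inj₁ (q , s))
       ; (inj₂ ((p , q) , s))      → inj₂ (p , inj₂ (q , s)) })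
  One-≋′ r ⊕-identityʳ   = (λ { (inj₁ (p , _)) → p }) , (λ p → inj₁ (p , tt))
  One-≋′ r ≋-refl        = id , id
  One-≋′ r (≋-sym p)     = let f , g = One-≋′ r p in g , f
  One-≋′ r (≋-trans p q) =
    let f , g = One-≋′ r p; f′ , g′ = One-≋′ r q in f′ ∘ f , g ∘ g′
  One-≋′ r (⊕-cong p q)  =
    let f , g = One-≋′ r p; f′ , g′ = One-≋′ r q
        z , w = Zero-≋ p; z′ , w′ = Zero-≋ q
    in (λ { (inj₁ (x , y)) → inj₁ (f x , z′ y) ; (inj₂ (x , y)) → inj₂ (z x , f′ y) }) ,
       (λ { (inj₁ (x , y)) → inj₁ (g x , w′ y) ; (inj₂ (x , y)) → inj₂ (w x , g′ y) })
  One-≋′ r (⇒-cong p q)  =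
    let e = unit-injective p in r (e ⇒ q) , r (≋ᵘ-sym e ⇒ ≋-sym q)
  One-≋′ r (Π-cong p)    =
    let e = unit-injective p in r (Π e) , r (Π ≋ᵘ-sym e)

  unit-injective : {U V : UnitType k} → unit U ≋ unit V → U ≋ᵘ V
  unit-injective {U = U} p = proj₁ (One-≋′ {P = U ≋ᵘ_} (λ e f → ≋ᵘ-trans f e) p) (≋ᵘ-refl U)

One-≋ : {P : UnitType k → Set} → Respects P → {T R : Type k} → T ≋ R → One P T → One P R
One-≋ r p = proj₁ (One-≋′ r p)

≋-unit : (U : UnitType k) {T : Type k} → T ≋ unit U → One (U ≋ᵘ_) T
≋-unit U p = One-≋ (λ e f → ≋ᵘ-trans f e) (≋-sym p) (≋ᵘ-refl U)

One⇒≋ : (U : UnitType k) (T : Type k) → One (U ≋ᵘ_) T → T ≋ unit U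
One⇒≋ U (unit V) e              = ≋-sym (≋ᵘ⇒≋ e)
One⇒≋ U (T ⊕ R)  (inj₁ (p , q)) =
  ≋-trans (⊕-cong (One⇒≋ U T p) (Zero⇒≋𝟘 R q)) ⊕-identityʳ
One⇒≋ U (T ⊕ R)  (inj₂ (p , q)) =
  ≋-trans (⊕-cong (Zero⇒≋𝟘 T p) (One⇒≋ U R q)) ⊕-identityˡ

-- A sum equivalent to a unit type has one summand ≋ 𝟘.
⊕≋unit : {T R : Type k} {U : UnitType k} → T ⊕ R ≋ unit U →
         (T ≋ unit U × R ≋ 𝟘) ⊎ (T ≋ 𝟘 × R ≋ unit U)
⊕≋unit {T = T} {R} {U} p with ≋-unit U p
... | inj₁ (o , z) = inj₁ (One⇒≋ U T o , Zero⇒≋𝟘 R z)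
... | inj₂ (z , o) = inj₂ (Zero⇒≋𝟘 T z , One⇒≋ U R o)

∑-empty : ∀ α (F : Vector (UnitType k) α) → Zero (∑ (unit ∘ F)) → α ≡ 0
∑-empty zero F _ = refl

-- The family F has length one and its element satisfies P.
data Single {k : ℕ} (P : UnitType k → Set) : ∀ α → Vector (UnitType k) α → Set where
  single : ∀ {F} → P (F zero) → Single P 1 F

One-∑ : {P : UnitType k → Set} → ∀ α (F : Vector (UnitType k) α) →
        One P (∑ (unit ∘ F)) → Single P α F
One-∑ (suc zero)    F (inj₂ (_ , p)) = single p
One-∑ (suc (suc α)) F (inj₂ ((_ , ()) , _))

-- Splitting a family of unit types along a decomposition of its sum.

module _ {k l : ℕ} {A : Set} (f : A → UnitType k) (g : A → Type l) where

  -- T is a sum of unit types f a, and R is the same sum with each f a replaced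
  -- by g a.  Both are read up to ≋, so that the relation is invariant in T and R.
  Reads : Type k → Type l → Set
  Reads (unit U) R = ∃[ a ] unit U ≋ unit (f a) × R ≋ g a
  Reads (T ⊕ S)  R = ∃[ R₁ ] ∃[ R₂ ] Reads T R₁ × Reads S R₂ × R ≋ R₁ ⊕ R₂
  Reads 𝟘        R = R ≋ 𝟘

  Reads-resp : ∀ T {R R′} → R′ ≋ R → Reads T R → Reads T R′
  Reads-resp (unit U) e (a , p , q)             = a , p , ≋-trans e q
  Reads-resp (T ⊕ S)  e (R₁ , R₂ , r₁ , r₂ , p) = R₁ , R₂ , r₁ , r₂ , ≋-trans e p
  Reads-resp 𝟘        e p                       = ≋-trans e p

  Reads-≋ : ∀ {T S R} → T ≋ S → (Reads T R → Reads S R) × (Reads S R → Reads T R)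
  Reads-≋ ⊕-comm =
    (λ (_ , _ , r₁ , r₂ , p) → _ , _ , r₂ , r₁ , ≋-trans p ⊕-comm) ,
    (λ (_ , _ , r₁ , r₂ , p) → _ , _ , r₂ , r₁ , ≋-trans p ⊕-comm)
  Reads-≋ ⊕-assoc =
    (λ (_ , _ , r₁ , (_ , _ , r₂ , r₃ , q) , p) →
       _ , _ , (_ , _ , r₁ , r₂ , ≋-refl) , r₃ ,
       ≋-trans p (≋-trans (⊕-cong ≋-refl q) ⊕-assoc)) ,
    (λ (_ , _ , (_ , _ , r₁ , r₂ , q) , r₃ , p) →
       _ , _ , r₁ , (_ , _ , r₂ , r₃ , ≋-refl) ,
       ≋-trans p (≋-trans (⊕-cong q ≋-refl) (≋-sym ⊕-assoc)))
  Reads-≋ {S = S} ⊕-identityʳ =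
    (λ (_ , _ , r , z , p) →
       Reads-resp S (≋-trans p (≋-trans (⊕-cong ≋-refl z) ⊕-identityʳ)) r) ,
    (λ r → _ , 𝟘 , r , ≋-refl , ≋-sym ⊕-identityʳ)
  Reads-≋ ≋-refl        = id , id
  Reads-≋ (≋-sym p)     = let f , g = Reads-≋ p in g , f
  Reads-≋ (≋-trans p q) =
    (λ r → proj₁ (Reads-≋ q) (proj₁ (Reads-≋ p) r)) ,
    (λ r → proj₂ (Reads-≋ p) (proj₂ (Reads-≋ q) r))
  Reads-≋ (⊕-cong p q)  =
    (λ (_ , _ , r₁ , r₂ , e) → _ , _ , proj₁ (Reads-≋ p) r₁ , proj₁ (Reads-≋ q) r₂ , e) ,
    (λ (_ , _ , r₁ , r₂ , e) → _ , _ , proj₂ (Reads-≋ p) r₁ , proj₂ (Reads-≋ q) r₂ , e)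
  Reads-≋ (⇒-cong p q)  =
    (λ (a , e , h) → a , ≋-trans (≋-sym (⇒-cong p q)) e , h) ,
    (λ (a , e , h) → a , ≋-trans (⇒-cong p q) e , h)
  Reads-≋ (Π-cong p)    =
    (λ (a , e , h) → a , ≋-trans (≋-sym (Π-cong p)) e , h) ,
    (λ (a , e , h) → a , ≋-trans (Π-cong p) e , h)

  Reads-∑ : (a : Vector A α) → Reads (∑ (unit ∘ f ∘ a)) (∑ (g ∘ a))
  Reads-∑ {α = zero}  a = ≋-refl
  Reads-∑ {α = suc α} a =
    _ , _ , Reads-∑ (init a) , (last a , ≋-refl , ≋-refl) , ≋-refl

  -- `Reads`, with the sum put in the form ∑ required by rule ⇒-E.
  record Indexed (T : Type k) (R : Type l) : Set where
    constructor indexed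
    field
      {size}  : ℕ
      indices : Vector A size
      source  : T ≋ ∑ (unit ∘ f ∘ indices)
      target  : R ≋ ∑ (g ∘ indices)

  Reads⇒Indexed : ∀ T {R} → Reads T R → Indexed T R
  Reads⇒Indexed (unit U) (a , p , q) =
    indexed (a ∷ []) (≋-trans p (≋-sym ⊕-identityˡ)) (≋-trans q (≋-sym ⊕-identityˡ))
  Reads⇒Indexed (T ⊕ S) (_ , _ , r₁ , r₂ , p)
    with indexed a s t ← Reads⇒Indexed T r₁ | indexed b s′ t′ ← Reads⇒Indexed S r₂ =
    indexed (a ++ b)
      (≋-trans (⊕-cong s s′) (≋-sym (∑-++ (unit ∘ f) a b)))
      (≋-trans p (≋-trans (⊕-cong t t′) (≋-sym (∑-++ g a b))))
  Reads⇒Indexed 𝟘 p = indexed [] ≋-refl p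

  -- If T ⊕ S is the sum of the f (a i), then T and S are the sums of f over two
  -- families that jointly have the same sum of g as a has.
  split-∑ : (a : Vector A α) {T S : Type k} → T ⊕ S ≋ ∑ (unit ∘ f ∘ a) →
            ∃[ R₁ ] ∃[ R₂ ] Indexed T R₁ × Indexed S R₂ × ∑ (g ∘ a) ≋ R₁ ⊕ R₂
  split-∑ a {T} {S} p =
    let _ , _ , r₁ , r₂ , e = proj₂ (Reads-≋ p) (Reads-∑ a)
    in _ , _ , Reads⇒Indexed T r₁ , Reads⇒Indexed S r₂ , e

-- Renaming and substitution in derivations.

-- The context weakened by one type variable.
⇑ : Context k n → Context (suc k) n
⇑ = Vec.map (renᵘ suc)

renᵗ-⊢ : {Γ : Context k m} {Δ : Context k n} {ρ : Fin m → Fin n} →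
         (∀ x → lookup Γ x ≡ lookup Δ (ρ x)) →
         ∀ {t T} → Γ ⊢ t ∶ T → Δ ⊢ renᵗ ρ t ∶ T
renᵗ-⊢ {Δ = Δ} {ρ} h (ax x) =
  subst (λ U → Δ ⊢ val (var (ρ x)) ∶ unit U) (sym (h x)) (ax (ρ x))
renᵗ-⊢ h ax-𝟘       = ax-𝟘
renᵗ-⊢ h (conv d p) = conv (renᵗ-⊢ h d) p
renᵗ-⊢ {m = m} {Γ = Γ} {Δ} {ρ} h (⇒-I {U = U} d) = ⇒-I (renᵗ-⊢ h′ d)
  where
  h′ : ∀ x → lookup (U Vec.∷ Γ) x ≡ lookup (U Vec.∷ Δ) (lift 1 ρ x)
  h′ zero    = refl
  h′ (suc x) = h x
renᵗ-⊢ h (⇒-E d e) = ⇒-E (renᵗ-⊢ h d) (renᵗ-⊢ h e)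
renᵗ-⊢ h (+-I d e) = +-I (renᵗ-⊢ h d) (renᵗ-⊢ h e)
renᵗ-⊢ h (Π-E d V) = Π-E (renᵗ-⊢ h d) V
renᵗ-⊢ {Γ = Γ} {Δ} {ρ} h (Π-I d) = Π-I (renᵗ-⊢ h′ d)
  where
  h′ : ∀ x → lookup (⇑ Γ) x ≡ lookup (⇑ Δ) (ρ x)
  h′ x = trans (lookup-map x (renᵘ suc) Γ)
         (trans (cong (renᵘ suc) (h x)) (sym (lookup-map (ρ x) (renᵘ suc) Δ)))

-- The substitution instance of Γ under σ is Δ, up to ≋ pointwise.
_≼[_]_ : Context k n → (Fin k → UnitType l) → Context l n → Set
Γ ≼[ σ ] Δ = ∀ x → unit (subᵘ σ (lookup Γ x)) ≋ unit (lookup Δ x)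

≼-∷ : {Γ : Context k n} {Δ : Context l n} {σ : Fin k → UnitType l} → Γ ≼[ σ ] Δ →
      ∀ {U V} → unit (subᵘ σ U) ≋ unit V → (U Vec.∷ Γ) ≼[ σ ] (V Vec.∷ Δ)
≼-∷ h p zero    = p
≼-∷ h p (suc x) = h x

≼-⇑ : {Γ : Context k n} {Δ : Context l n} {σ : Fin k → UnitType l} → Γ ≼[ σ ] Δ →
      ⇑ Γ ≼[ exts σ ] ⇑ Δ
≼-⇑ {Γ = Γ} {Δ} {σ} h x
  rewrite lookup-map x (renᵘ suc) Γ | lookup-map x (renᵘ suc) Δ | exts-renᵘ σ (lookup Γ x) =
  ren-≋ suc (h x)

-- Substituting for a fresh type variable leaves a context unchanged.
≼-inst₁ : (Γ : Context k n) (V : UnitType k) → ⇑ Γ ≼[ V ∷ var ] Γ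
≼-inst₁ Γ V x rewrite lookup-map x (renᵘ suc) Γ =
  ≡⇒≋ (cong unit (trans (sub-renᵘ (λ _ → refl) (lookup Γ x)) (sub-idᵘ (λ _ → refl) _)))

≼-weaken : (Γ : Context k n) → Γ ≼[ (λ X → var (suc X)) ] ⇑ Γ
≼-weaken Γ x rewrite lookup-map x (renᵘ suc) Γ =
  ≡⇒≋ (sym (ren≡sub suc (unit (lookup Γ x))))

-- Typing is stable under type substitution; σ = var gives conversion of contexts.
sub-⊢ : {Γ : Context k n} {Δ : Context l n} {σ : Fin k → UnitType l} → Γ ≼[ σ ] Δ →
        ∀ {t T} → Γ ⊢ t ∶ T → Δ ⊢ t ∶ sub σ T
sub-⊢ h (ax x)     = conv (ax x) (≋-sym (h x))
sub-⊢ h ax-𝟘       = ax-𝟘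
sub-⊢ h (conv d p) = conv (sub-⊢ h d) (sub-≋ _ p)
sub-⊢ {Γ = Γ} {Δ} h (⇒-I d) = ⇒-I (sub-⊢ (≼-∷ {Γ = Γ} {Δ} h ≋-refl) d)
sub-⊢ {σ = σ} h (⇒-E {m = m} {α = α} {β = β} {U = U} {T = T} {V = V} d e) =
  conv (⇒-E {U = subᵘ (exts* m σ) U} {T = sub (exts* m σ) ∘ T} {V = λ j → subᵘ σ ∘ V j}
         (conv (sub-⊢ h d)
            (≋-trans (≡⇒≋ (sub-∑ {α = α} σ _))
                     (∑-cong (λ i → ≡⇒≋ (cong unit (sub-Π* m σ (U ⇒ T i)))))))
         (conv (sub-⊢ h e)
            (≋-trans (≡⇒≋ (sub-∑ {α = β} σ _))
                     (∑-cong (λ j → ≡⇒≋ (cong unit (sym (sub-instᵘ m σ (V j) U))))))))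
       (≋-sym (≋-trans (≡⇒≋ (sub-∑ {α = α} σ _)) (∑-cong (λ i →
               ≋-trans (≡⇒≋ (sub-∑ {α = β} σ _)) (∑-cong (λ j →
               ≡⇒≋ (sym (sub-inst m σ (V j) (T i)))))))))
sub-⊢ h (+-I d e) = +-I (sub-⊢ h d) (sub-⊢ h e)
sub-⊢ {σ = σ} h (Π-E {U = U} d V) =
  conv (Π-E (sub-⊢ h d) (subᵘ σ V)) (≡⇒≋ (cong unit (sub-inst₁ σ V U)))
sub-⊢ {Γ = Γ} {Δ} h (Π-I d) = Π-I (sub-⊢ (≼-⇑ {Γ = Γ} {Δ} h) d)

context-≋ : {Γ Δ : Context k n} → (∀ x → unit (lookup Γ x) ≋ unit (lookup Δ x)) →
            ∀ {t T} → Γ ⊢ t ∶ T → Δ ⊢ t ∶ T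
context-≋ h d =
  conv (sub-⊢ (λ x → ≋-trans (≡⇒≋ (cong unit (sub-idᵘ (λ _ → refl) _))) (h x)) d)
       (≡⇒≋ (sub-id (λ _ → refl) _))

subᵗ-⊢ : {Γ : Context k m} {Δ : Context k n} {τ : Fin m → Value n} →
         (∀ x → Δ ⊢ val (τ x) ∶ unit (lookup Γ x)) →
         ∀ {t T} → Γ ⊢ t ∶ T → Δ ⊢ subᵗ τ t ∶ T
subᵗ-⊢ h (ax x)     = h x
subᵗ-⊢ h ax-𝟘       = ax-𝟘
subᵗ-⊢ h (conv d p) = conv (subᵗ-⊢ h d) p
subᵗ-⊢ {m = m} {Γ = Γ} {Δ} {τ} h (⇒-I {U = U} d) = ⇒-I (subᵗ-⊢ h′ d)
  where
  h′ : ∀ x → (U Vec.∷ Δ) ⊢ val ((var zero ∷ (renᵛ suc ∘ τ)) x) ∶ unit (lookup (U Vec.∷ Γ) x)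
  h′ zero    = ax zero
  h′ (suc x) = renᵗ-⊢ (λ _ → refl) (h x)
subᵗ-⊢ h (⇒-E d e) = ⇒-E (subᵗ-⊢ h d) (subᵗ-⊢ h e)
subᵗ-⊢ h (+-I d e) = +-I (subᵗ-⊢ h d) (subᵗ-⊢ h e)
subᵗ-⊢ h (Π-E d V) = Π-E (subᵗ-⊢ h d) V
subᵗ-⊢ {Γ = Γ} {Δ} {τ} h (Π-I d) = Π-I (subᵗ-⊢ h′ d)
  where
  h′ : ∀ x → ⇑ Δ ⊢ val (τ x) ∶ unit (lookup (⇑ Γ) x)
  h′ x rewrite lookup-map x (renᵘ suc) Γ =
    conv (sub-⊢ (≼-weaken Δ) (h x)) (≡⇒≋ (sym (ren≡sub suc (unit (lookup Γ x)))))

-- Generation.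

𝟎-generation : {Γ : Context k n} {T : Type k} → Γ ⊢ 𝟎 ∶ T → Zero T
𝟎-generation ax-𝟘       = tt
𝟎-generation (conv d p) = proj₁ (Zero-≋ p) (𝟎-generation d)
𝟎-generation (Π-E d V)  = 𝟎-generation d
𝟎-generation (Π-I d)    = 𝟎-generation d

value-generation : {Γ : Context k n} {v : Value n} {T : Type k} →
                   Γ ⊢ val v ∶ T → One (λ _ → ⊤) T
value-generation (ax x)     = tt
value-generation (conv d p) = One-≋ (λ _ → id) p (value-generation d)
value-generation (⇒-I d)    = tt
value-generation (Π-E d V)  = tt
value-generation (Π-I d)    = tt

-- What the body t of an abstraction must satisfy for val (ƛ t) to have type U in
-- context Γ.  The clause for Π weakens Γ just as rule Π-I does.  The clause for
-- variables is empty: no abstraction has a type variable as its type, and this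
-- leaves nothing to prove about it under a substitution.
Body : Context k n → Term (suc n) → UnitType k → Set
Body Γ t (var X) = ⊥
Body Γ t (U ⇒ T) = (U Vec.∷ Γ) ⊢ t ∶ T
Body Γ t (Π U)   = Body (⇑ Γ) t U

Body-sub : {Γ : Context k n} {Δ : Context l n} {σ : Fin k → UnitType l} → Γ ≼[ σ ] Δ →
           ∀ {t} U → Body Γ t U → Body Δ t (subᵘ σ U)
Body-sub {Γ = Γ} {Δ} h (U ⇒ T) d = sub-⊢ (≼-∷ {Γ = Γ} {Δ} h ≋-refl) d
Body-sub {Γ = Γ} {Δ} h (Π U)   b = Body-sub (≼-⇑ {Γ = Γ} {Δ} h) U b

Body-≋ᵘ : {Γ : Context k n} {t : Term (suc n)} → Respects (Body Γ t)
Body-≋ᵘ {Γ = Γ} (_⇒_ {U} {U′} p q) d = conv (context-≋ h d) q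
  where
  h : ∀ x → unit (lookup (U Vec.∷ Γ) x) ≋ unit (lookup (U′ Vec.∷ Γ) x)
  h zero    = ≋ᵘ⇒≋ p
  h (suc x) = ≋-refl
Body-≋ᵘ (Π p) b = Body-≋ᵘ p b

ƛ-generation : {Γ : Context k n} {t : Term (suc n)} {T : Type k} →
               Γ ⊢ val (ƛ t) ∶ T → One (Body Γ t) T
ƛ-generation (conv d p) = One-≋ Body-≋ᵘ p (ƛ-generation d)
ƛ-generation (⇒-I d)    = d
ƛ-generation {Γ = Γ} (Π-E {U = U} d V) = Body-sub (≼-inst₁ Γ V) U (ƛ-generation d)
ƛ-generation (Π-I d)    = ƛ-generation d

-- The context weakened by m type variables.
⇑* : ∀ m → Context k n → Context (m ℕ.+ k) n
⇑* zero    Γ = Γ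
⇑* (suc m) Γ = ⇑ (⇑* m Γ)

Body-Π* : ∀ m {Γ : Context k n} {t} {U : UnitType (m ℕ.+ k)} →
          Body Γ t (Π* m U) → Body (⇑* m Γ) t U
Body-Π* zero    b = b
Body-Π* (suc m) b = Body-Π* m b

≼-inst : ∀ m (Γ : Context k n) (V : Vector (UnitType k) m) → ⇑* m Γ ≼[ V ++ var ] Γ
≼-inst m Γ V x = ≡⇒≋ (cong unit (pointwise m V))
  where
  pointwise : ∀ m (V : Vector _ m) → subᵘ (V ++ var) (lookup (⇑* m Γ) x) ≡ lookup Γ x
  pointwise zero    V = sub-idᵘ (λ _ → refl) _
  pointwise (suc m) V rewrite lookup-map x (renᵘ suc) (⇑* m Γ) =
    trans (sub-renᵘ (++-suc m V var) (lookup (⇑* m Γ) x)) (pointwise m (tail V))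

strengthen-𝟘 : {Γ : Context k n} {t : Term n} → ⇑ Γ ⊢ t ∶ 𝟘 → Γ ⊢ t ∶ 𝟘
-- Any unit type can replace the superfluous variable; ∀X.X is a closed one.
strengthen-𝟘 {Γ = Γ} d = sub-⊢ (≼-inst₁ Γ (Π var zero)) d

-- Types of t and u whose sum is T.
record Summands {k n : ℕ} (Γ : Context k n) (t u : Term n) (T : Type k) : Set where
  constructor summands
  field
    {left right} : Type k
    ⊢left        : Γ ⊢ t ∶ left
    ⊢right       : Γ ⊢ u ∶ right
    sum          : left ⊕ right ≋ T

+-generation : {Γ : Context k n} {t u : Term n} {T : Type k} →
               Γ ⊢ t + u ∶ T → Summands Γ t u T
+-generation (conv d p) with summands a b q ← +-generation d = summands a b (≋-trans q p)
+-generation (+-I a b)  = summands a b ≋-refl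
+-generation (Π-E d V) with summands a b q ← +-generation d | ⊕≋unit q
... | inj₁ (p , z) = summands (Π-E (conv a p) V) (conv b z) ⊕-identityʳ
... | inj₂ (z , p) = summands (conv a z) (Π-E (conv b p) V) ⊕-identityˡ
+-generation (Π-I d) with summands a b q ← +-generation d | ⊕≋unit q
... | inj₁ (p , z) = summands (Π-I (conv a p)) (strengthen-𝟘 (conv b z)) ⊕-identityʳ
... | inj₂ (z , p) = summands (strengthen-𝟘 (conv a z)) (Π-I (conv b p)) ⊕-identityˡ

-- Preservation.

-- Every typing of t is a typing of t′, over all contexts and all scopes of type
-- variables; the latter is needed to pass under Π-I.
_⊑_ : Term n → Term n → Set
t ⊑ t′ = ∀ {k} {Γ : Context k _} {T} → Γ ⊢ t ∶ T → Γ ⊢ t′ ∶ T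

-- To retype an application it is enough to treat derivations ending in ⇒-E, as
-- conv, Π-E and Π-I can be reapplied to the result.
·-⊑ : {t u s : Term n} →
      (∀ {k m α β} {Γ : Context k n} {U : UnitType (m ℕ.+ k)}
         {T : Vector (Type (m ℕ.+ k)) α} {V : Vector (Vector (UnitType k) m) β} →
         Γ ⊢ t ∶ ∑ (λ i → unit (Π* m (U ⇒ T i))) →
         Γ ⊢ u ∶ ∑ (λ j → unit (U [ V j ]ᵘ)) →
         Γ ⊢ s ∶ ∑ (λ i → ∑ (λ j → T i [ V j ]))) →
      (t · u) ⊑ s
·-⊑ h (conv d p)        = conv (·-⊑ h d) p
·-⊑ h (⇒-E {U = U} d e) = h {U = U} d e
·-⊑ h (Π-E d V)         = Π-E (·-⊑ h d) V
·-⊑ h (Π-I d)           = Π-I (·-⊑ h d)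

+-cong-⊑ : {t t′ u u′ : Term n} → t ⊑ t′ → u ⊑ u′ → (t + u) ⊑ (t′ + u′)
+-cong-⊑ f g d with summands a b p ← +-generation d = conv (+-I (f a) (g b)) p

·-cong-⊑ : {t t′ u u′ : Term n} → t ⊑ t′ → u ⊑ u′ → (t · u) ⊑ (t′ · u′)
·-cong-⊑ f g = ·-⊑ (λ {_} {_} {_} {_} {_} {U} d e → ⇒-E {U = U} (f d) (g e))

ƛ-cong-⊑ : {t t′ : Term (suc n)} → t ⊑ t′ → val (ƛ t) ⊑ val (ƛ t′)
ƛ-cong-⊑ f (conv d p) = conv (ƛ-cong-⊑ f d) p
ƛ-cong-⊑ f (⇒-I d)    = ⇒-I (f d)
ƛ-cong-⊑ f (Π-E d V)  = Π-E (ƛ-cong-⊑ f d) V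
ƛ-cong-⊑ f (Π-I d)    = Π-I (ƛ-cong-⊑ f d)

+-comm-⊑ : {t u : Term n} → (t + u) ⊑ (u + t)
+-comm-⊑ d with summands a b p ← +-generation d = conv (+-I b a) (≋-trans ⊕-comm p)

+-assoc-⊑ : {t u s : Term n} → (t + u + s) ⊑ (t + (u + s))
+-assoc-⊑ d
  with summands ab c p ← +-generation d
  with summands a b q ← +-generation ab =
  conv (+-I a (+-I b c)) (≋-trans ⊕-assoc (≋-trans (⊕-cong q ≋-refl) p))

+-assoc-⊒ : {t u s : Term n} → (t + (u + s)) ⊑ (t + u + s)
+-assoc-⊒ d
  with summands a bc p ← +-generation d
  with summands b c q ← +-generation bc =
  conv (+-I (+-I a b) c) (≋-trans (≋-sym ⊕-assoc) (≋-trans (⊕-cong ≋-refl q) p))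

distribʳ-⊑ : {t u s : Term n} → ((t + u) · s) ⊑ (t · s + u · s)
distribʳ-⊑ = ·-⊑ λ {k} {m} {_} {_} {_} {U} {T} {V} d e →
  let summands a b p = +-generation d
      _ , _ , indexed T₁ s₁ r₁ , indexed T₂ s₂ r₂ , q =
        split-∑ (λ T → Π* m (U ⇒ T)) (λ T → ∑ (λ j → T [ V j ])) T p
  in conv (+-I (⇒-E {U = U} {T = T₁} {V = V} (conv a s₁) e)
               (⇒-E {U = U} {T = T₂} {V = V} (conv b s₂) e))
          (≋-sym (≋-trans q (⊕-cong r₁ r₂)))

distribˡ-⊑ : {t u s : Term n} → (t · (u + s)) ⊑ (t · u + t · s)
distribˡ-⊑ = ·-⊑ λ {_} {_} {_} {_} {_} {U} {T} {V} d e →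
  let summands a b p = +-generation e
      _ , _ , indexed V₁ s₁ r₁ , indexed V₂ s₂ r₂ , q =
        split-∑ (λ V → U [ V ]ᵘ) (λ V → ∑ (λ i → T i [ V ])) V p
  in conv (+-I (⇒-E {U = U} {T = T} {V = V₁} d (conv a s₁))
               (⇒-E {U = U} {T = T} {V = V₂} d (conv b s₂)))
          (≋-trans (⊕-cong (≋-trans (∑-swap (λ i j → T i [ V₁ j ])) (≋-sym r₁))
                           (≋-trans (∑-swap (λ i j → T i [ V₂ j ])) (≋-sym r₂)))
          (≋-trans (≋-sym q) (∑-swap (λ j i → T i [ V j ]))))

zeroˡ-⊑ : {t : Term n} → (𝟎 · t) ⊑ 𝟎
zeroˡ-⊑ = ·-⊑ λ {_} {_} {α} d e → lemma {α = α} (∑-empty α _ (𝟎-generation d))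
  where
  lemma : ∀ {k} {Γ : Context k n} {F : Vector (Type k) α} → α ≡ 0 → Γ ⊢ 𝟎 ∶ ∑ F
  lemma refl = ax-𝟘

zeroʳ-⊑ : {t : Term n} → (t · 𝟎) ⊑ 𝟎
zeroʳ-⊑ = ·-⊑ λ {_} {_} {α} {β} d e → lemma {α = α} (∑-empty β _ (𝟎-generation e))
  where
  lemma : ∀ {k} {Γ : Context k n} {F : Fin α → Vector (Type k) β} → β ≡ 0 →
          Γ ⊢ 𝟎 ∶ ∑ (λ i → ∑ (F i))
  lemma {α = α} refl = conv ax-𝟘 (≋-sym (∑-𝟘 α))

+-zero-⊑ : {t : Term n} → (t + 𝟎) ⊑ t
+-zero-⊑ d with summands a b p ← +-generation d =
  conv a (≋-trans (≋-sym (≋-trans (⊕-cong ≋-refl (Zero⇒≋𝟘 _ (𝟎-generation b))) ⊕-identityʳ)) p)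

beta-⊑ : {t : Term (suc n)} {v : Value n} → (val (ƛ t) · val v) ⊑ (t ⟨ v ⟩)
beta-⊑ = ·-⊑ contract
  where
  -- Values have a single unit type, so α = β = 1 and the ∑s are 𝟘 ⊕ _.
  contract : ∀ {k m α β} {t : Term (suc n)} {v : Value n}
             {Γ : Context k n} {U : UnitType (m ℕ.+ k)}
             {T : Vector (Type (m ℕ.+ k)) α} {V : Vector (Vector (UnitType k) m) β} →
             Γ ⊢ val (ƛ t) ∶ ∑ (λ i → unit (Π* m (U ⇒ T i))) →
             Γ ⊢ val v ∶ ∑ (λ j → unit (U [ V j ]ᵘ)) →
             Γ ⊢ t ⟨ v ⟩ ∶ ∑ (λ i → ∑ (λ j → T i [ V j ]))
  contract {m = m} {α} {β} {v = v} {Γ = Γ} {U} {T} {V} d e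
    with single b ← One-∑ α (λ i → Π* m (U ⇒ T i)) (ƛ-generation d)
    with single _ ← One-∑ β (λ j → U [ V j ]ᵘ) (value-generation e) =
    conv (subᵗ-⊢ ⊢v (Body-sub (≼-inst m Γ (V zero)) (U ⇒ T zero) (Body-Π* m b)))
         (≋-sym (≋-trans ⊕-identityˡ ⊕-identityˡ))
    where
    ⊢v : ∀ x → Γ ⊢ val ((v ∷ var) x) ∶ unit (lookup (U [ V zero ]ᵘ Vec.∷ Γ) x)
    ⊢v zero    = conv e ⊕-identityˡ
    ⊢v (suc x) = ax x

≈⇒⊑ : {t u : Term n} → t ≈ u → t ⊑ u × u ⊑ t
≈⇒⊑ +-comm        = +-comm-⊑ , +-comm-⊑
≈⇒⊑ +-assoc       = +-assoc-⊑ , +-assoc-⊒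
≈⇒⊑ ≈-refl        = id , id
≈⇒⊑ (≈-sym p)     = let f , g = ≈⇒⊑ p in g , f
≈⇒⊑ (≈-trans p q) =
  let f , g = ≈⇒⊑ p; f′ , g′ = ≈⇒⊑ q in (λ d → f′ (f d)) , (λ d → g (g′ d))
≈⇒⊑ (ƛ-cong p)    = let f , g = ≈⇒⊑ p in ƛ-cong-⊑ f , ƛ-cong-⊑ g
≈⇒⊑ (·-cong p q)  =
  let f , g = ≈⇒⊑ p; f′ , g′ = ≈⇒⊑ q in ·-cong-⊑ f f′ , ·-cong-⊑ g g′
≈⇒⊑ (+-cong p q)  =
  let f , g = ≈⇒⊑ p; f′ , g′ = ≈⇒⊑ q in +-cong-⊑ f f′ , +-cong-⊑ g g′

↦⇒⊑ : {t u : Term n} → t ↦ u → t ⊑ u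
↦⇒⊑ distribʳ = distribʳ-⊑
↦⇒⊑ distribˡ = distribˡ-⊑
↦⇒⊑ zeroˡ    = zeroˡ-⊑
↦⇒⊑ zeroʳ    = zeroʳ-⊑
↦⇒⊑ +-zero   = +-zero-⊑
↦⇒⊑ beta     = beta-⊑
↦⇒⊑ (ξ-ƛ r)  = ƛ-cong-⊑ (↦⇒⊑ r)
↦⇒⊑ (ξ-·ˡ r) = ·-cong-⊑ (↦⇒⊑ r) id
↦⇒⊑ (ξ-·ʳ r) = ·-cong-⊑ id (↦⇒⊑ r)
↦⇒⊑ (ξ-+ˡ r) = +-cong-⊑ (↦⇒⊑ r) id
↦⇒⊑ (ξ-+ʳ r) = +-cong-⊑ id (↦⇒⊑ r)

theorem4 : ∀ {k n : ℕ} (t t′ : Term n) (Γ : Context k n) (T : Type k) →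
    t ⟶* t′ → Γ ⊢ t ∶ T → Γ ⊢ t′ ∶ T
theorem4 t t′ Γ T ε d = d
theorem4 t t′ Γ T (inj₁ p ◅ rs) d = theorem4 _ t′ Γ T rs (proj₁ (≈⇒⊑ p) d)
theorem4 t t′ Γ T (inj₂ (_ , _ , p , r , q) ◅ rs) d =
  theorem4 _ t′ Γ T rs (proj₁ (≈⇒⊑ q) (↦⇒⊑ r (proj₁ (≈⇒⊑ p) d)))
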